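{- There is an algorithm $\mathcal{A}$ such that for any $w$-element poset $(W,\le)$ and any $k\in[w]$, the $N$ many $k$-element order ideals of $(W,\le)$ get enumerated by $\mathcal{A}$ in output-polynomial time $O(Nw^3)$.
   Context: $[w]=\{1,2,\dots,w\}$. An order ideal of a poset $(W,\le)$ is a subset $X\subseteq W$ such that $p\in X$ and $q\le p$ imply $q\in X$. To enumerate a collection of sets means to produce (list) all of them, one by one. The poset is given, say, by a $w\times w$ incidence matrix of $\le$. The constant implied by $O(\cdot)$ is independent of the poset, $w$ and $k$. -}

module Defs where

open import Data.Bool.Base using (Bool; true; false; if_then_else_)
open import Data.Fin.Base using (Fin; fromℕ<; remQuot)
open import Data.Fin.Subset using (Subset; _∈_; ∣_∣)
open import Data.List.Base using (List; []; _∷_; _++_; concatMap)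
open import Data.List.Membership.Propositional using () renaming (_∈_ to _∈ₗ_)
open import Data.List.Relation.Unary.Unique.Propositional using (Unique)
open import Data.Nat.Base using (ℕ; _+_; _*_; _∸_; _≡ᵇ_)
open import Data.Nat.Properties using (_<?_)
open import Data.Product.Base using (_×_; _,_)
import Data.Vec.Base as Vec
open import Function.Bundles using (Inverse; _⇔_)
open import Level using (0ℓ)
open import Relation.Binary.Bundles using (DecPoset)
open import Relation.Binary.PropositionalEquality using (_≡_; _≢_; setoid)
open import Relation.Nullary.Decidable.Core using (yes; no; does)

-- A uniform-cost random access machine, programmed in structured form.  A
-- program mentions only finitely many variables and arrays, whose names are
-- literals in its text; only array *indices* are computed at run time.  There
-- is no multiplication, so a run of length t only produces numbers with O(t)
-- more bits than its input.

record State : Set where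
  constructor mkState
  field
    var : ℕ → ℕ
    arr : ℕ → ℕ → ℕ

open State public

data Expr : Set where
  lit     : ℕ → Expr
  get     : ℕ → Expr
  _[_]    : ℕ → Expr → Expr
  _⊕_ _⊖_ : Expr → Expr → Expr

infixl 7 _⊕_ _⊖_
infix  8 _[_]

⟦_⟧ : Expr → State → ℕ
⟦ lit n ⟧   σ = n
⟦ get x ⟧   σ = var σ x
⟦ a [ e ] ⟧ σ = arr σ a (⟦ e ⟧ σ)
⟦ d ⊕ e ⟧   σ = ⟦ d ⟧ σ + ⟦ e ⟧ σ
⟦ d ⊖ e ⟧   σ = ⟦ d ⟧ σ ∸ ⟦ e ⟧ σ

cost : Expr → ℕ
cost (lit n)   = 1
cost (get x)   = 1
cost (a [ e ]) = 1 + cost e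
cost (d ⊕ e)   = 1 + cost d + cost e
cost (d ⊖ e)   = 1 + cost d + cost e

data Program : Set where
  skip        : Program
  _≔_         : ℕ → Expr → Program
  _[_]≔_      : ℕ → Expr → Expr → Program
  emit        : Expr → Program
  _⨾_         : Program → Program → Program
  ifnz_∶_else_ : Expr → Program → Program → Program
  whilenz_∶_  : Expr → Program → Program

infix  6 _≔_ _[_]≔_
infixr 4 _⨾_
infixr 5 ifnz_∶_else_ whilenz_∶_

_[_↦_] : {A : Set} → (ℕ → A) → ℕ → A → (ℕ → A)
(f [ x ↦ v ]) y = if y ≡ᵇ x then v else f y

setVar : ℕ → ℕ → State → State
setVar x v σ = mkState (var σ [ x ↦ v ]) (arr σ)

setArr : ℕ → ℕ → ℕ → State → State
setArr a i v σ = mkState (var σ) (arr σ [ a ↦ arr σ a [ i ↦ v ] ])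

-- ⟨ c , σ ⟩⇓⟨ τ , out , t ⟩ : started in σ, the program c halts in τ after t
-- steps, having written the list out to its output tape.
infix 3 ⟨_,_⟩⇓⟨_,_,_⟩

data ⟨_,_⟩⇓⟨_,_,_⟩ : Program → State → State → List ℕ → ℕ → Set where
  ⇓skip : ∀ {σ} →
    ⟨ skip , σ ⟩⇓⟨ σ , [] , 1 ⟩
  ⇓assign : ∀ {σ x e} →
    ⟨ x ≔ e , σ ⟩⇓⟨ setVar x (⟦ e ⟧ σ) σ , [] , 1 + cost e ⟩
  ⇓store : ∀ {σ a d e} →
    ⟨ a [ d ]≔ e , σ ⟩⇓⟨ setArr a (⟦ d ⟧ σ) (⟦ e ⟧ σ) σ , [] , 1 + cost d + cost e ⟩
  ⇓emit : ∀ {σ e} →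
    ⟨ emit e , σ ⟩⇓⟨ σ , ⟦ e ⟧ σ ∷ [] , 1 + cost e ⟩
  ⇓seq : ∀ {c d σ τ υ o o′ t t′} →
    ⟨ c , σ ⟩⇓⟨ τ , o , t ⟩ →
    ⟨ d , τ ⟩⇓⟨ υ , o′ , t′ ⟩ →
    ⟨ c ⨾ d , σ ⟩⇓⟨ υ , o ++ o′ , t + t′ ⟩
  ⇓then : ∀ {e c d σ τ o t} →
    ⟦ e ⟧ σ ≢ 0 →
    ⟨ c , σ ⟩⇓⟨ τ , o , t ⟩ →
    ⟨ ifnz e ∶ c else d , σ ⟩⇓⟨ τ , o , 1 + cost e + t ⟩
  ⇓else : ∀ {e c d σ τ o t} →
    ⟦ e ⟧ σ ≡ 0 →
    ⟨ d , σ ⟩⇓⟨ τ , o , t ⟩ →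
    ⟨ ifnz e ∶ c else d , σ ⟩⇓⟨ τ , o , 1 + cost e + t ⟩
  ⇓done : ∀ {e c σ} →
    ⟦ e ⟧ σ ≡ 0 →
    ⟨ whilenz e ∶ c , σ ⟩⇓⟨ σ , [] , 1 + cost e ⟩
  ⇓loop : ∀ {e c σ τ υ o o′ t t′} →
    ⟦ e ⟧ σ ≢ 0 →
    ⟨ c , σ ⟩⇓⟨ τ , o , t ⟩ →
    ⟨ whilenz e ∶ c , τ ⟩⇓⟨ υ , o′ , t′ ⟩ →
    ⟨ whilenz e ∶ c , σ ⟩⇓⟨ υ , o ++ o′ , 1 + cost e + t + t′ ⟩

bit : Bool → ℕ
bit false = 0
bit true  = 1

-- P has exactly w elements (up to its own equality), numbered by Fin w.
Numbering : DecPoset 0ℓ 0ℓ 0ℓ → ℕ → Set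
Numbering P w = Inverse (DecPoset.Eq.setoid P) (setoid (Fin w))

module _ (P : DecPoset 0ℓ 0ℓ 0ℓ) {w : ℕ} (ν : Numbering P w) where
  open DecPoset P using (Carrier; _≤_; _≤?_)
  open Inverse ν using (to; from)

  -- A subset of the carrier is given by the set of numbers of its elements.
  IsOrderIdeal : Subset w → Set
  IsOrderIdeal X = ∀ (p q : Carrier) → to p ∈ X → q ≤ p → to q ∈ X

  IsListingOfIdeals : ℕ → List (Subset w) → Set
  IsListingOfIdeals k Xs =
    Unique Xs × (∀ X → X ∈ₗ Xs ⇔ (IsOrderIdeal X × ∣ X ∣ ≡ k))

  -- Row-major order: the entry for (i , j) is at index i * w + j.
  incidenceMatrix : ℕ → ℕ
  incidenceMatrix n with n <? w * w
  ... | no  _    = 0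
  ... | yes n<w² with remQuot {w} w (fromℕ< n<w²)
  ...   | i , j  = bit (does (from i ≤? from j))

  -- Variable 0 holds w, variable 1 holds k and array 0 holds the incidence
  -- matrix; everything else is 0.
  input : ℕ → State
  var (input k) 0 = w
  var (input k) 1 = k
  var (input k) _ = 0
  arr (input k) 0 = incidenceMatrix
  arr (input k) _ = λ _ → 0

-- Every set is written out as its characteristic vector, w numbers per set.
encode : ∀ {w} → List (Subset w) → List ℕ
encode = concatMap (λ X → Vec.toList (Vec.map bit X))

{-# OPTIONS --safe #-}

-- Decide for the elements 0 , … , w - 1 in turn whether they belong to the
-- ideal, by depth-first search in a binary tree.  Let I be the down-closure of
-- the elements taken so far and O the up-closure of those rejected so far.  A
-- node is cut off unless I ∩ O = ∅, ∣ I ∣ ≤ k and ∣ O ∣ + k ≤ w, which takes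
-- O(w²) steps to test.  This is necessary for a k-element ideal to exist below
-- the node.  It is also sufficient: if the next element d lies in neither I nor
-- O, then I ∪ ↓ d and O ∪ ↑ d meet in d only, so that their sizes add up to at
-- most w + 1 and one of the two choices for d passes the test again.  Hence
-- every node that is not cut off has an ideal below it, and O(N w) nodes are
-- visited.

module Submission where

open import Defs
open import Algebra.Properties.CommutativeSemigroup using (interchange)
open import Data.Bool.Base using (Bool; true; false; if_then_else_; not; _∧_; _∨_; T)
open import Data.Bool.Properties using (not-injective)
open import Data.Empty using (⊥; ⊥-elim)
open import Data.Fin.Base using (Fin; zero; suc; toℕ; fromℕ<; combine; remQuot)
open import Data.Fin.Properties using (toℕ-fromℕ<; toℕ<n; toℕ-injective; toℕ-combine; remQuot-combine)
open import Data.Fin.Subset using (Subset; ∣_∣) renaming (_∈_ to _∈ˢ_)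
open import Data.List.Base using (List; []; _∷_; _++_; length)
open import Data.List.Membership.Propositional using (_∈_)
open import Data.List.Membership.Propositional.Properties using (∈-++⁺ˡ; ∈-++⁺ʳ; ∈-++⁻)
open import Data.List.Properties using (length-++; ++-assoc; concatMap-++; ++-identityʳ)
open import Data.List.Relation.Unary.All using ([])
open import Data.List.Relation.Unary.AllPairs using ([]; _∷_)
open import Data.List.Relation.Unary.Any using (here)
open import Data.List.Relation.Unary.Unique.Propositional using (Unique)
import Data.List.Relation.Unary.Unique.Propositional.Properties as Unique
open import Data.Nat.Base using (ℕ; zero; suc; _+_; _*_; _∸_; _^_; _≤_; _<_; z≤n; s≤s; s≤s⁻¹; _≡ᵇ_)
open import Data.Nat.Properties
open import Data.Nat.Solver using (module +-*-Solver)
open import Data.Product.Base using (Σ-syntax; ∃-syntax; ∃₂; _×_; _,_)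
open import Data.Sum.Base using (_⊎_; inj₁; inj₂)
import Data.Vec.Base as Vec
open import Data.Vec.Base using ([]; _∷_; tabulate; lookup)
open import Data.Vec.Properties using (lookup∘tabulate; tabulate-cong; []=⇒lookup; lookup⇒[]=)
open import Function.Base using (_∘_; flip)
open import Function.Bundles using (Inverse; mk⇔)
open import Level using (0ℓ)
open import Relation.Binary.Bundles using (DecPoset)
open import Relation.Binary.PropositionalEquality
  using (_≡_; _≢_; refl; sym; trans; cong; cong₂; subst; subst₂; module ≡-Reasoning)
open import Relation.Nullary.Decidable.Core using (yes; no; does)
open import Relation.Nullary.Negation using (contradiction)
open +-*-Solver using (solve; con; _:+_; _:*_; _:=_)

-- Counting below a bound

≡ᵇ-refl : ∀ n → (n ≡ᵇ n) ≡ true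
≡ᵇ-refl zero    = refl
≡ᵇ-refl (suc n) = ≡ᵇ-refl n

≢⇒≡ᵇ-false : ∀ {m n} → m ≢ n → (m ≡ᵇ n) ≡ false
≢⇒≡ᵇ-false {m} {n} m≢n with m ≡ᵇ n in eq
... | false = refl
... | true  = contradiction (≡ᵇ⇒≡ m n (subst T (sym eq) _)) m≢n

↦-updates : ∀ {A : Set} (f : ℕ → A) n {v} → (f [ n ↦ v ]) n ≡ v
↦-updates f n rewrite ≡ᵇ-refl n = refl

↦-minimal : ∀ {A : Set} (f : ℕ → A) {m n v} → m ≢ n → (f [ n ↦ v ]) m ≡ f m
↦-minimal f m≢n rewrite ≢⇒≡ᵇ-false m≢n = refl

true≢false : ∀ {b} → b ≡ true → b ≡ false → ⊥
true≢false refl ()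

count : (ℕ → Bool) → ℕ → ℕ
count f zero    = 0
count f (suc n) = count f n + bit (f n)

bit-mono : ∀ {a b} → (a ≡ true → b ≡ true) → bit a ≤ bit b
bit-mono {false}         _   = z≤n
bit-mono {true}  {true}  _   = ≤-refl
bit-mono {true}  {false} imp with () ← imp refl

count-mono : ∀ {f g} n → (∀ {q} → q < n → f q ≡ true → g q ≡ true) → count f n ≤ count g n
count-mono zero    _   = z≤n
count-mono (suc n) imp = +-mono-≤ (count-mono n (imp ∘ m<n⇒m<1+n)) (bit-mono (imp ≤-refl))

count-not : ∀ f n → count f n + count (not ∘ f) n ≡ n
count-not f zero    = refl
count-not f (suc n) with f n
... | true  = trans (cong₂ _+_ (+-comm (count f n) 1) (+-identityʳ _)) (cong suc (count-not f n))
... | false = trans (cong₂ _+_ (+-identityʳ (count f n)) (+-comm (count (not ∘ f) n) 1))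
                    (trans (+-suc _ _) (cong suc (count-not f n)))

bit-disjoint : ∀ {a b} → (a ≡ true → b ≡ true → ⊥) → bit a + bit b ≤ 1
bit-disjoint {true}  {true}  dis = ⊥-elim (dis refl refl)
bit-disjoint {true}  {false} _   = ≤-refl
bit-disjoint {false} {true}  _   = ≤-refl
bit-disjoint {false} {false} _   = z≤n

bit≤1 : ∀ b → bit b ≤ 1
bit≤1 true  = ≤-refl
bit≤1 false = z≤n

count-disjoint : ∀ {f g} n → (∀ {q} → q < n → f q ≡ true → g q ≡ true → ⊥) →
                 count f n + count g n ≤ n
count-disjoint zero    _   = z≤n
count-disjoint {f} {g} (suc n) dis = begin
  (count f n + bit (f n)) + (count g n + bit (g n))  ≡⟨ interchange +-commutativeSemigroup (count f n) _ _ _ ⟩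
  (count f n + count g n) + (bit (f n) + bit (g n))  ≤⟨ +-mono-≤ (count-disjoint n (dis ∘ m<n⇒m<1+n)) (bit-disjoint (dis ≤-refl)) ⟩
  n + 1                                              ≡⟨ +-comm n 1 ⟩
  suc n                                              ∎
  where open ≤-Reasoning

-- Only `p` can be counted twice. If the topmost element is common to both sets, then it is `p`, and
-- `count-disjoint` handles everything below it.
count-overlap : ∀ {f g p} n → (∀ {q} → q < n → f q ≡ true → g q ≡ true → q ≡ p) →
                count f n + count g n ≤ suc n
count-overlap zero _ = z≤n
count-overlap {f} {g} {p} (suc n) only with f n in fn | g n in gn
... | true | true = begin
  (count f n + 1) + (count g n + 1)  ≡⟨ interchange +-commutativeSemigroup (count f n) _ _ _ ⟩
  (count f n + count g n) + 2        ≤⟨ +-monoˡ-≤ 2 (count-disjoint n disjoint) ⟩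
  n + 2                              ≡⟨ +-comm n 2 ⟩
  suc (suc n)                        ∎
  where
  open ≤-Reasoning
  disjoint : ∀ {q} → q < n → f q ≡ true → g q ≡ true → ⊥
  disjoint q<n fq gq =
    <⇒≢ q<n (trans (only (m<n⇒m<1+n q<n) fq gq) (sym (only ≤-refl fn gn)))
... | true | false = begin
  (count f n + 1) + (count g n + 0)  ≡⟨ interchange +-commutativeSemigroup (count f n) _ _ _ ⟩
  (count f n + count g n) + 1        ≤⟨ +-monoˡ-≤ 1 (count-overlap n (only ∘ m<n⇒m<1+n)) ⟩
  suc n + 1                          ≡⟨ +-comm (suc n) 1 ⟩
  suc (suc n)                        ∎
  where open ≤-Reasoning
... | false | b = begin
  (count f n + 0) + (count g n + bit b)  ≡⟨ interchange +-commutativeSemigroup (count f n) _ _ _ ⟩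
  (count f n + count g n) + bit b        ≤⟨ +-mono-≤ (count-overlap n (only ∘ m<n⇒m<1+n)) (bit≤1 b) ⟩
  suc n + 1                              ≡⟨ +-comm (suc n) 1 ⟩
  suc (suc n)                            ∎
  where open ≤-Reasoning

-- The search tree

-- A single step along `R` suffices, because `R` will be an order or its converse and hence
-- transitive below `w`.
closure : (ℕ → ℕ → Bool) → (ℕ → Bool) → ℕ → ℕ → Bool
closure R s zero    q = false
closure R s (suc d) q = closure R s d q ∨ (s d ∧ R q d)

closure⁺ : ∀ {R s p q} d → p < d → s p ≡ true → R q p ≡ true → closure R s d q ≡ true
closure⁺ {R} {s} {p} {q} (suc d) p<1+d sp Rqp with m<1+n⇒m<n∨m≡n p<1+d
... | inj₁ p<d rewrite closure⁺ {R} {s} d p<d sp Rqp = refl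
... | inj₂ refl rewrite sp | Rqp with closure R s d q
...   | true  = refl
...   | false = refl

closure⁻ : ∀ {R s q} d → closure R s d q ≡ true → ∃[ p ] p < d × s p ≡ true × R q p ≡ true
closure⁻ {R} {s} {q} (suc d) c with closure R s d q in eq
closure⁻ {R} {s} {q} (suc d) c | true with p , p<d , sp , Rqp ← closure⁻ d eq =
  p , m<n⇒m<1+n p<d , sp , Rqp
closure⁻ {R} {s} {q} (suc d) c | false with s d in sd
closure⁻ {R} {s} {q} (suc d) c | false | true = d , ≤-refl , sd , c

closure-suc⁻ : ∀ {R s s′ q} d → (∀ {p} → p < d → s′ p ≡ s p) → closure R s′ (suc d) q ≡ true →
               closure R s d q ≡ true ⊎ (s′ d ≡ true × R q d ≡ true)
closure-suc⁻ d agree c with closure⁻ (suc d) c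
... | p , p<1+d , sp , Rqp with m<1+n⇒m<n∨m≡n p<1+d
...   | inj₁ p<d  = inj₁ (closure⁺ d p<d (trans (sym (agree p<d)) sp) Rqp)
...   | inj₂ refl = inj₂ (sp , Rqp)

module Search
  (w k : ℕ) (le : ℕ → ℕ → Bool)
  (le-refl    : ∀ {a} → a < w → le a a ≡ true)
  (le-trans   : ∀ {a b c} → a < w → b < w → c < w → le a b ≡ true → le b c ≡ true → le a c ≡ true)
  (le-antisym : ∀ {a b} → a < w → b < w → le a b ≡ true → le b a ≡ true → a ≡ b)
  where

  IsIdeal : (ℕ → Bool) → Set
  IsIdeal s = (∀ {a b} → a < w → b < w → le b a ≡ true → s a ≡ true → s b ≡ true) × count s w ≡ k

  -- The elements that the choices s for 0 , … , d - 1 force into, respectively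
  -- out of, every order ideal respecting them.
  forcedIn forcedOut clash : (ℕ → Bool) → ℕ → ℕ → Bool
  forcedIn  s     = closure le s
  forcedOut s     = closure (flip le) (not ∘ s)
  clash     s d q = forcedIn s d q ∧ forcedOut s d q

  record Feasible (s : ℕ → Bool) (d : ℕ) : Set where
    constructor feasible
    field
      consistent : ∀ {q} → q < w → forcedIn s d q ≡ true → forcedOut s d q ≡ true → ⊥
      in≤k       : count (forcedIn s d) w ≤ k
      out+k≤w    : count (forcedOut s d) w + k ≤ w

  -- Truncated subtraction makes each summand vanish exactly when the corresponding field of
  -- `Feasible` holds, so that the program decides feasibility by one comparison of `defectE` with
  -- 0.
  defect : (ℕ → Bool) → ℕ → ℕ
  defect s d = count (clash s d) w + (count (forcedIn s d) w ∸ k) + (count (forcedOut s d) w + k ∸ w)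

  count≡0⇒false : ∀ {f q} n → count f n ≡ 0 → q < n → f q ≡ false
  count≡0⇒false {f} (suc n) eq q<1+n with m<1+n⇒m<n∨m≡n q<1+n
  ... | inj₁ q<n = count≡0⇒false n (m+n≡0⇒m≡0 (count f n) eq) q<n
  ... | inj₂ refl with f n | m+n≡0⇒n≡0 (count f n) eq
  ...   | false | _ = refl

  false⇒count≡0 : ∀ {f} n → (∀ {q} → q < n → f q ≡ false) → count f n ≡ 0
  false⇒count≡0 zero    _ = refl
  false⇒count≡0 (suc n) h rewrite false⇒count≡0 n (h ∘ m<n⇒m<1+n) | h {n} ≤-refl = refl

  defect≡0⇒feasible : ∀ {s d} → defect s d ≡ 0 → Feasible s d
  defect≡0⇒feasible {s} {d} eq = feasible
    (λ {q} q<w i o → true≢false (cong₂ _∧_ i o) (count≡0⇒false {clash s d} {q} w (m+n≡0⇒m≡0 _ eq′) q<w))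
    (m∸n≡0⇒m≤n (m+n≡0⇒n≡0 (count (clash s d) w) eq′))
    (m∸n≡0⇒m≤n (m+n≡0⇒n≡0 (count (clash s d) w + (count (forcedIn s d) w ∸ k)) eq))
    where eq′ = m+n≡0⇒m≡0 (count (clash s d) w + (count (forcedIn s d) w ∸ k)) eq

  feasible⇒defect≡0 : ∀ {s d} → Feasible s d → defect s d ≡ 0
  feasible⇒defect≡0 {s} {d} (feasible apart in≤k out+k≤w) =
    cong₂ _+_ (cong₂ _+_ (false⇒count≡0 w no-clash) (m≤n⇒m∸n≡0 in≤k)) (m≤n⇒m∸n≡0 out+k≤w)
    where
    no-clash : ∀ {q} → q < w → clash s d q ≡ false
    no-clash {q} q<w with forcedIn s d q in i | forcedOut s d q in o
    ... | true  | true  = ⊥-elim (apart q<w i o)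
    ... | true  | false = refl
    ... | false | _     = refl

  choose : (ℕ → Bool) → ℕ → Bool → (ℕ → Bool)
  choose s d b = s [ d ↦ b ]

  choose-minimal : ∀ {s d b p} → p < d → choose s d b p ≡ s p
  choose-minimal {s} p<d = ↦-minimal s (<⇒≢ p<d)

  forcedIn-choose⁻ : ∀ {s d b q} → forcedIn (choose s d b) (suc d) q ≡ true →
                     forcedIn s d q ≡ true ⊎ (b ≡ true × le q d ≡ true)
  forcedIn-choose⁻ {s} {d} {b} {q} c with closure-suc⁻ {le} {s} {q = q} d (choose-minimal {s}) c
  ... | inj₁ i       = inj₁ i
  ... | inj₂ (e , l) = inj₂ (trans (sym (↦-updates s d)) e , l)

  forcedOut-choose⁻ : ∀ {s d b q} → forcedOut (choose s d b) (suc d) q ≡ true →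
                      forcedOut s d q ≡ true ⊎ (b ≡ false × le d q ≡ true)
  forcedOut-choose⁻ {s} {d} {b} {q} c
    with closure-suc⁻ {flip le} {not ∘ s} {q = q} d (cong not ∘ choose-minimal {s}) c
  ... | inj₁ i       = inj₁ i
  ... | inj₂ (e , l) = inj₂ (trans (sym (↦-updates s d)) (not-injective e) , l)

  -- In `feasible-choose` this settles an element that is already forced: making the forced choice
  -- enlarges neither set.
  Feasible-mono : ∀ {s d s′ d′} → Feasible s d →
                  (∀ {q} → q < w → forcedIn  s′ d′ q ≡ true → forcedIn  s d q ≡ true) →
                  (∀ {q} → q < w → forcedOut s′ d′ q ≡ true → forcedOut s d q ≡ true) →
                  Feasible s′ d′
  Feasible-mono (feasible apart in≤k out+k≤w) in⊆ out⊆ = feasible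
    (λ q<w i o → apart q<w (in⊆ q<w i) (out⊆ q<w o))
    (≤-trans (count-mono w in⊆) in≤k)
    (≤-trans (+-monoˡ-≤ k (count-mono w out⊆)) out+k≤w)

  forcedIn-↓ : ∀ {s d a b} → d ≤ w → a < w → b < w →
               le b a ≡ true → forcedIn s d a ≡ true → forcedIn s d b ≡ true
  forcedIn-↓ {d = d} d≤w a<w b<w b≤a i with p , p<d , sp , a≤p ← closure⁻ d i =
    closure⁺ d p<d sp (le-trans b<w a<w (<-≤-trans p<d d≤w) b≤a a≤p)

  forcedOut-↑ : ∀ {s d a b} → d ≤ w → a < w → b < w →
                le a b ≡ true → forcedOut s d a ≡ true → forcedOut s d b ≡ true
  forcedOut-↑ {d = d} d≤w a<w b<w a≤b o with p , p<d , sp , p≤a ← closure⁻ d o =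
    closure⁺ d p<d sp (le-trans (<-≤-trans p<d d≤w) a<w b<w p≤a a≤b)

  -- If d is free, then forcing it in and forcing it out overlap in d only, so
  -- that the two counts add up to at most w + 1 and cannot both be too large.
  feasible-choose : ∀ {s d} → d < w → Feasible s d →
                    ∃[ b ] Feasible (choose s d b) (suc d)
  feasible-choose {s} {d} d<w F@(feasible apart in≤k out+k≤w) with forcedIn s d d in id | forcedOut s d d in od
  ... | true | _ = true , Feasible-mono F in⊆ out⊆
    where
    in⊆ : ∀ {q} → q < w → forcedIn (choose s d true) (suc d) q ≡ true → forcedIn s d q ≡ true
    in⊆ q<w c with forcedIn-choose⁻ {s} {d} c
    ... | inj₁ i       = i
    ... | inj₂ (_ , l) = forcedIn-↓ {s} {d} (<⇒≤ d<w) d<w q<w l id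
    out⊆ : ∀ {q} → q < w → forcedOut (choose s d true) (suc d) q ≡ true → forcedOut s d q ≡ true
    out⊆ q<w c with inj₁ o ← forcedOut-choose⁻ {s} {d} c = o
  ... | false | true = false , Feasible-mono F in⊆ out⊆
    where
    in⊆ : ∀ {q} → q < w → forcedIn (choose s d false) (suc d) q ≡ true → forcedIn s d q ≡ true
    in⊆ q<w c with inj₁ i ← forcedIn-choose⁻ {s} {d} c = i
    out⊆ : ∀ {q} → q < w → forcedOut (choose s d false) (suc d) q ≡ true → forcedOut s d q ≡ true
    out⊆ q<w c with forcedOut-choose⁻ {s} {d} c
    ... | inj₁ o       = o
    ... | inj₂ (_ , l) = forcedOut-↑ {s} {d} (<⇒≤ d<w) d<w q<w l od
  -- Taking a free `d` leaves the forced-out set as it is, and a clash below `d` would force `d`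
  -- out, as that set is closed upwards. So taking `d` can fail only by size.
  ... | false | false with count (forcedIn (choose s d true) (suc d)) w ≤? k
  ...   | yes in′≤k = true , feasible apart′ in′≤k
            (≤-trans (+-monoˡ-≤ k (count-mono w out⊆)) out+k≤w)
    where
    out⊆ : ∀ {q} → q < w → forcedOut (choose s d true) (suc d) q ≡ true → forcedOut s d q ≡ true
    out⊆ q<w c with inj₁ o ← forcedOut-choose⁻ {s} {d} c = o
    apart′ : ∀ {q} → q < w → forcedIn (choose s d true) (suc d) q ≡ true →
           forcedOut (choose s d true) (suc d) q ≡ true → ⊥
    apart′ q<w i o with forcedIn-choose⁻ {s} {d} i
    ... | inj₁ i′      = apart q<w i′ (out⊆ q<w o)
    ... | inj₂ (_ , l) = true≢false (forcedOut-↑ {s} {d} (<⇒≤ d<w) q<w d<w l (out⊆ q<w o)) od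
  ...   | no in′≰k = false , feasible apart′ (≤-trans (count-mono w in⊆) in≤k) out′+k≤w
    where
    in⊆ : ∀ {q} → q < w → forcedIn (choose s d false) (suc d) q ≡ true → forcedIn s d q ≡ true
    in⊆ q<w c with inj₁ i ← forcedIn-choose⁻ {s} {d} c = i
    apart′ : ∀ {q} → q < w → forcedIn (choose s d false) (suc d) q ≡ true →
           forcedOut (choose s d false) (suc d) q ≡ true → ⊥
    apart′ q<w i o with forcedOut-choose⁻ {s} {d} o
    ... | inj₁ o′      = apart q<w (in⊆ q<w i) o′
    ... | inj₂ (_ , l) = true≢false (forcedIn-↓ {s} {d} (<⇒≤ d<w) q<w d<w l (in⊆ q<w i)) id
    -- A common element in both old sets contradicts feasibility; one in a single old set would put
    -- `d` there too, although `d` is free. What remains lies below and above `d`.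
    only-d : ∀ {q} → q < w → forcedIn (choose s d true) (suc d) q ≡ true →
             forcedOut (choose s d false) (suc d) q ≡ true → q ≡ d
    only-d q<w i o with forcedIn-choose⁻ {s} {d} i | forcedOut-choose⁻ {s} {d} o
    ... | inj₁ i′      | inj₁ o′       = ⊥-elim (apart q<w i′ o′)
    ... | inj₁ i′      | inj₂ (_ , l)  = ⊥-elim (true≢false (forcedIn-↓ {s} {d} (<⇒≤ d<w) q<w d<w l i′) id)
    ... | inj₂ (_ , l) | inj₁ o′       = ⊥-elim (true≢false (forcedOut-↑ {s} {d} (<⇒≤ d<w) q<w d<w l o′) od)
    ... | inj₂ (_ , l) | inj₂ (_ , l′) = le-antisym q<w d<w l l′
    out′+k≤w : count (forcedOut (choose s d false) (suc d)) w + k ≤ w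
    -- Since taking `d` failed, the forced-in set would have at least `k + 1` elements; the overlap
    -- bound `w + 1` then leaves at most `w ∸ k` for the forced-out set.
    out′+k≤w = s≤s⁻¹ (begin
      suc (count (forcedOut (choose s d false) (suc d)) w + k)
        ≡⟨ cong suc (+-comm _ k) ⟩
      suc k + count (forcedOut (choose s d false) (suc d)) w
        ≤⟨ +-monoˡ-≤ _ (≰⇒> in′≰k) ⟩
      count (forcedIn (choose s d true) (suc d)) w + count (forcedOut (choose s d false) (suc d)) w
        ≤⟨ count-overlap w only-d ⟩
      suc w ∎)
      where open ≤-Reasoning

  -- By reflexivity the forced sets contain `s` and its complement. Their disjointness gives
  -- downward closure, and the two size bounds squeeze the size of `s` to `k`.
  feasible⇒ideal : ∀ {s} → Feasible s w → IsIdeal s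
  feasible⇒ideal {s} (feasible apart in≤k out+k≤w) = down , ≤-antisym size≤k k≤size
    where
    down : ∀ {a b} → a < w → b < w → le b a ≡ true → s a ≡ true → s b ≡ true
    down {a} {b} a<w b<w b≤a sa with s b in sb
    ... | true  = refl
    ... | false = ⊥-elim (apart b<w (closure⁺ w a<w sa b≤a) (closure⁺ w b<w (cong not sb) (le-refl b<w)))
    size≤k : count s w ≤ k
    size≤k = ≤-trans (count-mono w (λ q<w sq → closure⁺ w q<w sq (le-refl q<w))) in≤k
    k≤size : k ≤ count s w
    k≤size = +-cancelˡ-≤ (count (not ∘ s) w) k (count s w) (begin
      count (not ∘ s) w + k          ≤⟨ +-monoˡ-≤ k (count-mono w (λ q<w sq → closure⁺ w q<w sq (le-refl q<w))) ⟩
      count (forcedOut s w) w + k    ≤⟨ out+k≤w ⟩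
      w                              ≡⟨ count-not s w ⟨
      count s w + count (not ∘ s) w  ≡⟨ +-comm (count s w) _ ⟩
      count (not ∘ s) w + count s w  ∎)
      where open ≤-Reasoning

  -- The forced sets lie inside `s′` and inside its complement, of sizes `k` and `w ∸ k`.
  -- Contrapositively, cutting off an infeasible node loses no ideal.
  ideal⇒feasible : ∀ {s s′ d} → d ≤ w → (∀ {p} → p < d → s′ p ≡ s p) → IsIdeal s′ → Feasible s d
  ideal⇒feasible {s} {s′} {d} d≤w agree (down , size) = feasible
    (λ q<w i o → true≢false (in⊆ q<w i) (not-injective (out⊆ q<w o)))
    (≤-trans (count-mono w in⊆) (≤-reflexive size))
    (begin
      count (forcedOut s d) w + k      ≤⟨ +-monoˡ-≤ k (count-mono w out⊆) ⟩
      count (not ∘ s′) w + k           ≡⟨ cong (count (not ∘ s′) w +_) size ⟨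
      count (not ∘ s′) w + count s′ w  ≡⟨ +-comm _ (count s′ w) ⟩
      count s′ w + count (not ∘ s′) w  ≡⟨ count-not s′ w ⟩
      w                                ∎)
    where
    open ≤-Reasoning
    in⊆ : ∀ {q} → q < w → forcedIn s d q ≡ true → s′ q ≡ true
    in⊆ q<w i with p , p<d , sp , q≤p ← closure⁻ d i =
      down (<-≤-trans p<d d≤w) q<w q≤p (trans (agree p<d) sp)
    out⊆ : ∀ {q} → q < w → forcedOut s d q ≡ true → not (s′ q) ≡ true
    out⊆ {q} q<w o with p , p<d , sp , p≤q ← closure⁻ d o with s′ q in sq
    ... | false = refl
    ... | true  = ⊥-elim (true≢false (down q<w (<-≤-trans p<d d≤w) p≤q sq) (trans (agree p<d) (not-injective sp)))

  -- Listing the ideals by recursion on the tree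

  subset : (ℕ → Bool) → Subset w
  subset s = tabulate (s ∘ toℕ)

  subset-cong : ∀ {s s′} → (∀ {p} → p < w → s p ≡ s′ p) → subset s ≡ subset s′
  subset-cong agree = tabulate-cong (λ i → agree (toℕ<n i))

  subset-injective : ∀ {s s′ p} → p < w → subset s ≡ subset s′ → s p ≡ s′ p
  subset-injective {s} {s′} {p} p<w eq = begin
    s p                          ≡⟨ cong s (toℕ-fromℕ< p<w) ⟨
    s (toℕ i)                    ≡⟨ lookup∘tabulate (s ∘ toℕ) i ⟨
    lookup (subset s) i          ≡⟨ cong (λ X → lookup X i) eq ⟩
    lookup (subset s′) i         ≡⟨ lookup∘tabulate (s′ ∘ toℕ) i ⟩
    s′ (toℕ i)                   ≡⟨ cong s′ (toℕ-fromℕ< p<w) ⟩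
    s′ p                         ∎
    where
    open ≡-Reasoning
    i = fromℕ< p<w

  -- ideals m d s lists the ideals that agree with s below d; m = w - d
  -- choices are still open.
  ideals expand : ℕ → ℕ → (ℕ → Bool) → List (Subset w)
  ideals m d s = if defect s d ≡ᵇ 0 then expand m d s else []
  expand zero    d s = subset s ∷ []
  expand (suc m) d s = ideals m (suc d) (choose s d false) ++ ideals m (suc d) (choose s d true)

  ideals-feasible : ∀ m {d s} → defect s d ≡ 0 → ideals m d s ≡ expand m d s
  ideals-feasible m eq rewrite eq = refl

  ideals-infeasible : ∀ m {d s} → defect s d ≢ 0 → ideals m d s ≡ []
  ideals-infeasible m ≢0 rewrite ≢⇒≡ᵇ-false ≢0 = refl

  open-choice : ∀ {m d} → suc m + d ≡ w → d < w
  open-choice {m} {d} eq = ≤-trans (s≤s (m≤n+m d m)) (≤-reflexive eq)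

  next-choice : ∀ {m d} → suc m + d ≡ w → m + suc d ≡ w
  next-choice {m} {d} = trans (+-suc m d)

  -- There are no dead ends, since `feasible-choose` always leaves a feasible child. This is what
  -- allows the cost of inner nodes to be charged to the output.
  ideals-nonempty : ∀ m {d s} → m + d ≡ w → defect s d ≡ 0 → 1 ≤ length (ideals m d s)
  ideals-nonempty zero            eq ok rewrite ok = ≤-refl
  ideals-nonempty (suc m) {d} {s} eq ok
    with b , F ← feasible-choose (open-choice eq) (defect≡0⇒feasible {s} {d} ok)
    rewrite ok | length-++ (ideals m (suc d) (choose s d false)) {ideals m (suc d) (choose s d true)}
    with b
  ... | false = ≤-trans (ideals-nonempty m (next-choice eq) (feasible⇒defect≡0 F)) (m≤m+n _ _)
  ... | true  = ≤-trans (ideals-nonempty m (next-choice eq) (feasible⇒defect≡0 F)) (m≤n+m _ _)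

  Extends : ℕ → (ℕ → Bool) → (ℕ → Bool) → Set
  Extends d s s′ = ∀ {p} → p < d → s′ p ≡ s p

  Extends-choose⁻ : ∀ {d s s′ b} → Extends (suc d) (choose s d b) s′ → Extends d s s′
  Extends-choose⁻ {s = s} ext p<d = trans (ext (m<n⇒m<1+n p<d)) (choose-minimal {s} p<d)

  -- The value of `s′` at `d` tells which of the two children to follow.
  Extends-choose⁺ : ∀ {d s s′} → Extends d s s′ → Extends (suc d) (choose s d (s′ d)) s′
  Extends-choose⁺ {d} {s} ext p<1+d with m<1+n⇒m<n∨m≡n p<1+d
  ... | inj₁ p<d  = trans (ext p<d) (sym (choose-minimal {s} p<d))
  ... | inj₂ refl = sym (↦-updates s d)

  -- `Extends` is kept in the conclusion so that `ideals-unique` can tell the two branches apart by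
  -- their value at `d`.
  ideals-sound : ∀ m {d s X} → m + d ≡ w → X ∈ ideals m d s →
                 ∃[ s′ ] X ≡ subset s′ × Extends d s s′ × IsIdeal s′
  ideals-sound m {d} {s} eq X∈ with defect s d in def
  ideals-sound zero {d} {s} refl (here refl) | zero =
    s , refl , (λ _ → refl) , feasible⇒ideal (defect≡0⇒feasible def)
  ideals-sound (suc m) {d} {s} eq X∈ | zero
    with ∈-++⁻ (ideals m (suc d) (choose s d false)) X∈
  ... | inj₁ X∈₀ with s′ , X≡ , ext , ideal ← ideals-sound m (next-choice eq) X∈₀ =
    s′ , X≡ , Extends-choose⁻ {s = s} ext , ideal
  ... | inj₂ X∈₁ with s′ , X≡ , ext , ideal ← ideals-sound m (next-choice eq) X∈₁ =
    s′ , X≡ , Extends-choose⁻ {s = s} ext , ideal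

  ideals-complete : ∀ m {d s s′} → m + d ≡ w → Extends d s s′ → IsIdeal s′ → subset s′ ∈ ideals m d s
  ideals-complete m {d} {s} {s′} eq ext ideal
    -- An ideal below the node rules out that it is cut off, so `ideals` unfolds to `expand`.
    rewrite feasible⇒defect≡0 (ideal⇒feasible {s} {s′} (≤-trans (m≤n+m d m) (≤-reflexive eq)) ext ideal)
    with m
  ... | zero  = here (subset-cong (λ {p} p<w → ext (subst (p <_) (sym eq) p<w)))
  ... | suc m with s′ d | Extends-choose⁺ {s = s} ext
  ...   | false | ext′ = ∈-++⁺ˡ (ideals-complete m (next-choice eq) ext′ ideal)
  ...   | true  | ext′ = ∈-++⁺ʳ (ideals m (suc d) (choose s d false)) (ideals-complete m (next-choice eq) ext′ ideal)

  ideals-unique : ∀ m {d s} → m + d ≡ w → Unique (ideals m d s)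
  ideals-unique m {d} {s} eq with defect s d
  ideals-unique m eq | suc _ = []
  ideals-unique zero eq | zero = [] ∷ []
  ideals-unique (suc m) {d} {s} eq | zero =
    Unique.++⁺ (ideals-unique m (next-choice eq)) (ideals-unique m (next-choice eq)) disjoint
    where
    disjoint : ∀ {X} → X ∈ ideals m (suc d) (choose s d false) × X ∈ ideals m (suc d) (choose s d true) → ⊥
    disjoint (X∈₀ , X∈₁)
      with s₀ , X≡₀ , ext₀ , _ ← ideals-sound m (next-choice eq) X∈₀
         | s₁ , X≡₁ , ext₁ , _ ← ideals-sound m (next-choice eq) X∈₁
      = true≢false {s₁ d} (trans (ext₁ ≤-refl) (↦-updates s d))
          (trans (subset-injective {s₁} {s₀} (open-choice {m} {d} eq) (trans (sym X≡₁) X≡₀))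
                 (trans (ext₀ ≤-refl) (↦-updates s d)))

-- The program and its runs

-- Array 0 and variables 0 and 1 are where `input` stores the matrix, `w` and `k`. Arrays and
-- variables have separate name spaces.
order chosen : ℕ
order  = 0
chosen = 1

#w #k depth descending this other rowStart inPtr outPtr isIn isOut clashes ins outs : ℕ
#w         = 0
#k         = 1
depth      = 2
descending = 3
this       = 4
other      = 5
rowStart   = 6
inPtr      = 7
outPtr     = 8
isIn       = 9
isOut      = 10
clashes    = 11
ins        = 12
outs       = 13

-- On bits, 1 ∸ ((1 ∸ x) ∸ y) is a disjunction, x ∸ y is x and not y, and
-- x ∸ (1 ∸ y) is a conjunction.
comparePair : Program
comparePair =
  isIn  ≔ lit 1 ⊖ ((lit 1 ⊖ get isIn)  ⊖ (chosen [ get other ] ⊖ (lit 1 ⊖ order [ get inPtr ]))) ⨾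
  isOut ≔ lit 1 ⊖ ((lit 1 ⊖ get isOut) ⊖ (order [ get outPtr ] ⊖ chosen [ get other ])) ⨾
  -- The machine cannot multiply, so matrix indices are maintained by addition: `inPtr` walks along
  -- row `this`, `outPtr` down column `this`.
  inPtr  ≔ lit 1 ⊕ get inPtr ⨾
  outPtr ≔ get #w ⊕ get outPtr ⨾
  other  ≔ lit 1 ⊕ get other

classify : Program
classify =
  isIn   ≔ lit 0 ⨾
  isOut  ≔ lit 0 ⨾
  inPtr  ≔ get rowStart ⨾
  outPtr ≔ get this ⨾
  other  ≔ lit 0 ⨾
  (whilenz get depth ⊖ get other ∶ comparePair) ⨾
  clashes  ≔ get clashes ⊕ (get isIn ⊖ (lit 1 ⊖ get isOut)) ⨾
  ins      ≔ get ins  ⊕ get isIn ⨾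
  outs     ≔ get outs ⊕ get isOut ⨾
  rowStart ≔ get #w ⊕ get rowStart ⨾
  this     ≔ lit 1 ⊕ get this

examine : Program
examine =
  clashes  ≔ lit 0 ⨾
  ins      ≔ lit 0 ⨾
  outs     ≔ lit 0 ⨾
  rowStart ≔ lit 0 ⨾
  this     ≔ lit 0 ⨾
  whilenz get #w ⊖ get this ∶ classify

print : Program
print =
  this ≔ lit 0 ⨾
  whilenz get #w ⊖ get this ∶
    (emit (chosen [ get this ]) ⨾ this ≔ lit 1 ⊕ get this)

defectE : Expr
defectE = get clashes ⊕ (get ins ⊖ get #k) ⊕ (get outs ⊕ get #k ⊖ get #w)

visit : Program
visit =
  examine ⨾
  (ifnz defectE ∶ descending ≔ lit 0
   else (ifnz get #w ⊖ get depth ∶ (chosen [ get depth ]≔ lit 0 ⨾ depth ≔ lit 1 ⊕ get depth)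
         else (print ⨾ descending ≔ lit 0)))

-- `chosen` doubles as the stack of the search. An entry 0 means that the rejecting branch is
-- finished and the accepting one is next; an entry 1 means that both are finished and the parent is
-- left as well.
retreat : Program
retreat =
  depth ≔ get depth ⊖ lit 1 ⨾
  (ifnz chosen [ get depth ] ∶ skip
   else (chosen [ get depth ]≔ lit 1 ⨾ depth ≔ lit 1 ⊕ get depth ⨾ descending ≔ lit 1))

step search enumerate : Program
step      = ifnz get descending ∶ visit else retreat
-- The sum is 0 only once the root itself is being left.
search    = whilenz get descending ⊕ get depth ∶ step
enumerate = descending ≔ lit 1 ⨾ search

-- Total correctness with time bounds

record Run (c : Program) (σ : State) (T : ℕ) (Q : State → List ℕ → Set) : Set where
  constructor running
  field
    {final}    : State
    {output}   : List ℕ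
    {steps}    : ℕ
    derivation : ⟨ c , σ ⟩⇓⟨ final , output , steps ⟩
    steps≤T    : steps ≤ T
    post       : Q final output

Run-⨾ : ∀ {c d σ T T′ Q R} → Run c σ T Q →
        (∀ {τ o} → Q τ o → Run d τ T′ (λ υ o′ → R υ (o ++ o′))) → Run (c ⨾ d) σ (T + T′) R
Run-⨾ (running c≤ t≤ q) next with running d≤ t′≤ r ← next q =
  running (⇓seq c≤ d≤) (+-mono-≤ t≤ t′≤) r

Run-≔ : ∀ {x e d σ T R} → Run d (setVar x (⟦ e ⟧ σ) σ) T R → Run (x ≔ e ⨾ d) σ (1 + cost e + T) R
Run-≔ {e = e} (running d≤ t≤ r) = running (⇓seq ⇓assign d≤) (+-monoʳ-≤ (1 + cost e) t≤) r

Run-mono : ∀ {c σ T T′ Q R} → T ≤ T′ → (∀ τ {o} → Q τ o → R τ o) → Run c σ T Q → Run c σ T′ R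
Run-mono T≤ imp (running c≤ t≤ q) = running c≤ (≤-trans t≤ T≤) (imp _ q)

module _ (Inv : ℕ → State → Set) (chunk : ℕ → List ℕ) where

  chunks : ℕ → ℕ → List ℕ
  chunks zero    j = []
  chunks (suc m) j = chunk j ++ chunks m (suc j)

  -- A counted loop: the guard `n ∸ j` is the number of passes left, so induction on it gives
  -- termination. The trailing `1 + cost e` pays for the last, failing test.
  Run-while : ∀ {e c T n} →
    (∀ {j σ} → Inv j σ → ⟦ e ⟧ σ ≡ n ∸ j) →
    (∀ {j σ} → j < n → Inv j σ → Run c σ T (λ τ o → Inv (suc j) τ × o ≡ chunk j)) →
    ∀ m {j σ} → m + j ≡ n → Inv j σ →
    Run (whilenz e ∶ c) σ (m * (1 + cost e + T) + (1 + cost e)) (λ τ o → Inv n τ × o ≡ chunks m j)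
  Run-while guard body zero {j} refl inv =
    running (⇓done (trans (guard inv) (n∸n≡0 j))) ≤-refl (inv , refl)
  Run-while {e} {c} {T} guard body (suc m) {j} refl inv
    with running c≤ t≤ (inv′ , refl) ← body (s≤s (m≤n+m j m)) inv
    with running l≤ t′≤ (inv″ , refl) ← Run-while guard body m (+-suc m j) inv′
    = running
        (⇓loop (λ ≡0 → m≢0 (trans (sym (m+n∸n≡m (suc m) j)) (trans (sym (guard inv)) ≡0))) c≤ l≤)
        (≤-trans (+-mono-≤ (+-monoʳ-≤ (1 + cost e) t≤) t′≤)
                 (≤-reflexive (sym (+-assoc (1 + cost e + T) (m * (1 + cost e + T)) (1 + cost e)))))
        (inv″ , refl)
    where
    m≢0 : suc m ≢ 0
    m≢0 ()

chunks-[] : ∀ {Inv} m {j} → chunks Inv (λ _ → []) m j ≡ []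
chunks-[] zero    = refl
chunks-[] {Inv} (suc m) = chunks-[] {Inv} m

bit-step-in : ∀ {x y z a b c} → x ≡ bit a → y ≡ bit b → z ≡ bit c →
              1 ∸ ((1 ∸ x) ∸ (y ∸ (1 ∸ z))) ≡ bit (a ∨ (b ∧ c))
bit-step-in {a = true}  {true}  {true}  refl refl refl = refl
bit-step-in {a = true}  {true}  {false} refl refl refl = refl
bit-step-in {a = true}  {false} {true}  refl refl refl = refl
bit-step-in {a = true}  {false} {false} refl refl refl = refl
bit-step-in {a = false} {true}  {true}  refl refl refl = refl
bit-step-in {a = false} {true}  {false} refl refl refl = refl
bit-step-in {a = false} {false} {true}  refl refl refl = refl
bit-step-in {a = false} {false} {false} refl refl refl = refl

bit-step-out : ∀ {x y z a b c} → x ≡ bit a → y ≡ bit b → z ≡ bit c →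
               1 ∸ ((1 ∸ x) ∸ (z ∸ y)) ≡ bit (a ∨ (not b ∧ c))
bit-step-out {a = true}  {true}  {true}  refl refl refl = refl
bit-step-out {a = true}  {true}  {false} refl refl refl = refl
bit-step-out {a = true}  {false} {true}  refl refl refl = refl
bit-step-out {a = true}  {false} {false} refl refl refl = refl
bit-step-out {a = false} {true}  {true}  refl refl refl = refl
bit-step-out {a = false} {true}  {false} refl refl refl = refl
bit-step-out {a = false} {false} {true}  refl refl refl = refl
bit-step-out {a = false} {false} {false} refl refl refl = refl

bit-∧ : ∀ {x y a b} → x ≡ bit a → y ≡ bit b → x ∸ (1 ∸ y) ≡ bit (a ∧ b)
bit-∧ {a = true}  {true}  refl refl = refl
bit-∧ {a = true}  {false} refl refl = refl
bit-∧ {a = false} {true}  refl refl = refl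
bit-∧ {a = false} {false} refl refl = refl

-- Examining and printing a node

module Correctness
  (w k : ℕ) (le : ℕ → ℕ → Bool)
  (le-refl    : ∀ {a} → a < w → le a a ≡ true)
  (le-trans   : ∀ {a b c} → a < w → b < w → c < w → le a b ≡ true → le b c ≡ true → le a c ≡ true)
  (le-antisym : ∀ {a b} → a < w → b < w → le a b ≡ true → le b a ≡ true → a ≡ b)
  where
  open Search w k le le-refl le-trans le-antisym

  Stores : ℕ → (ℕ → Bool) → (ℕ → ℕ) → Set
  Stores d s f = ∀ {j} → j < d → f j ≡ bit (s j)

  -- Mode m = 1 enters the node given by the first d choices of s; mode m = 0
  -- leaves it.
  At : ℕ → ℕ → (ℕ → Bool) → State → Set
  At m d s σ =
    var σ #w ≡ w × var σ #k ≡ k ×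
    (∀ {a b} → a < w → b < w → arr σ order (a * w + b) ≡ bit (le a b)) ×
    var σ depth ≡ d × var σ descending ≡ m × Stores d s (arr σ chosen)

  module _ {m d : ℕ} {s : ℕ → Bool} where

    Classified : ℕ → State → Set
    Classified q σ =
      At m d s σ × var σ this ≡ q × var σ rowStart ≡ q * w ×
      var σ clashes ≡ count (clash s d) q ×
      var σ ins ≡ count (forcedIn s d) q ×
      var σ outs ≡ count (forcedOut s d) q

    -- Cutting the closures off at `p` instead of `d` turns the recursion that defines `closure`
    -- into the invariant of the inner loop.
    Compared : ℕ → ℕ → State → Set
    Compared q p σ =
      Classified q σ × var σ other ≡ p ×
      var σ isIn ≡ bit (forcedIn s p q) × var σ isOut ≡ bit (forcedOut s p q) ×
      var σ inPtr ≡ q * w + p × var σ outPtr ≡ p * w + q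

    comparePair-run : ∀ {q p σ} → d ≤ w → q < w → p < d → Compared q p σ →
                  Run comparePair σ 44 (λ τ o → Compared q (suc p) τ × o ≡ [])
    comparePair-run {q} {p} {σ} d≤w q<w p<d
      (inv@((#w≡ , _ , matrix , _ , _ , stores) , _) , other≡ , in≡ , out≡ , inPtr≡ , outPtr≡) =
      running (⇓seq ⇓assign (⇓seq ⇓assign (⇓seq ⇓assign (⇓seq ⇓assign ⇓assign)))) (≤ᵇ⇒≤ _ _ _)
        ( ( inv , cong suc other≡
          , bit-step-in {a = forcedIn s p q} in≡ sp (trans (cong (arr σ order) inPtr≡) (matrix q<w p<w))
          , bit-step-out {a = forcedOut s p q} out≡ sp (trans (cong (arr σ order) outPtr≡) (matrix p<w q<w))
          , trans (cong suc inPtr≡) (sym (+-suc (q * w) p))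
          , trans (cong₂ _+_ #w≡ outPtr≡) (sym (+-assoc w (p * w) q)))
        , refl)
      where
      p<w = <-≤-trans p<d d≤w
      sp : arr σ chosen (var σ other) ≡ bit (s p)
      sp = trans (cong (arr σ chosen) other≡) (stores p<d)

    classify-run : ∀ {q σ} → d ≤ w → q < w → Classified q σ →
                   Run classify σ (38 + w * 48) (λ τ o → Classified (suc q) τ × o ≡ [])
    classify-run {q} {σ} d≤w q<w inv@((#w≡ , _ , _ , depth≡ , _) , this≡ , rowStart≡ , _) =
      Run-mono bound (λ _ r → r)
        (Run-≔ (Run-≔ (Run-≔ (Run-≔ (Run-≔
          (Run-⨾ (Run-while (Compared q) (λ _ → [])
                   (λ ((((_ , _ , _ , depth≡ , _) , _) , other≡ , _)) → cong₂ _∸_ depth≡ other≡)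
                   (comparePair-run d≤w q<w) d (+-identityʳ d)
                   (inv , refl , refl , refl , trans rowStart≡ (sym (+-identityʳ (q * w))) , this≡))
                 finish))))))
      where
      finish : ∀ {τ o} → Compared q d τ × o ≡ chunks (Compared q) (λ _ → []) d 0 →
               Run (clashes  ≔ get clashes ⊕ (get isIn ⊖ (lit 1 ⊖ get isOut)) ⨾
                    ins      ≔ get ins  ⊕ get isIn ⨾
                    outs     ≔ get outs ⊕ get isOut ⨾
                    rowStart ≔ get #w ⊕ get rowStart ⨾
                    this     ≔ lit 1 ⊕ get this) τ 24
                 (λ υ o′ → Classified (suc q) υ × o ++ o′ ≡ [])
      finish ((((at@(#w≡ , _) , this≡ , rowStart≡ , clashes≡ , ins≡ , outs≡)
              , _ , isIn≡ , isOut≡ , _)) , refl) =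
        running (⇓seq ⇓assign (⇓seq ⇓assign (⇓seq ⇓assign (⇓seq ⇓assign ⇓assign)))) (≤ᵇ⇒≤ _ _ _)
          ( ( at , cong suc this≡ , cong₂ _+_ #w≡ rowStart≡
            , cong₂ _+_ clashes≡ (bit-∧ {a = forcedIn s d q} isIn≡ isOut≡)
            , cong₂ _+_ ins≡ isIn≡ , cong₂ _+_ outs≡ isOut≡)
          , trans (++-identityʳ _) (chunks-[] {Compared q} d))
      -- Initialisation costs 10, each pass 44 for the body and 4 for the test, the last test 4 and
      -- the closing assignments 24.
      bound : 10 + (d * 48 + 4 + 24) ≤ 38 + w * 48
      bound = ≤-trans (+-monoʳ-≤ 10 (≤-reflexive (trans (+-assoc (d * 48) 4 24) (+-comm (d * 48) 28))))
                      (+-monoʳ-≤ 38 (*-monoˡ-≤ 48 d≤w))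

    examine-run : ∀ {σ} → d ≤ w → At m d s σ →
                  Run examine σ (10 + (w * (42 + w * 48) + 4))
                    (λ τ o → (At m d s τ × ⟦ defectE ⟧ τ ≡ defect s d) × o ≡ [])
    examine-run {σ} d≤w at =
      Run-mono ≤-refl finish
        (Run-≔ (Run-≔ (Run-≔ (Run-≔ (Run-≔
          (Run-while Classified (λ _ → [])
            (λ ((#w≡ , _) , this≡ , _) → cong₂ _∸_ #w≡ this≡)
            (classify-run d≤w) w (+-identityʳ w)
            (at , refl , refl , refl , refl , refl)))))))
      where
      finish : ∀ τ {o} → Classified w τ × o ≡ chunks Classified (λ _ → []) w 0 →
               (At m d s τ × ⟦ defectE ⟧ τ ≡ defect s d) × o ≡ []
      finish _ ((at@(#w≡ , #k≡ , _) , _ , _ , clashes≡ , ins≡ , outs≡) , refl) =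
        (at , cong₂ _+_ (cong₂ _+_ clashes≡ (cong₂ _∸_ ins≡ #k≡))
                        (cong₂ _∸_ (cong₂ _+_ outs≡ #k≡) #w≡))
        , chunks-[] {Classified} w

    Printed : ℕ → State → Set
    Printed j σ = At m d s σ × var σ this ≡ j

    print-run : ∀ {σ} → d ≡ w → At m d s σ →
                Run print σ (2 + (w * 11 + 4)) (λ τ o → At m d s τ × o ≡ Vec.toList (Vec.map bit (subset s)))
    print-run {σ} refl at =
      Run-mono ≤-refl (λ { _ ((at , _) , refl) → at , chunks-tabulate w 0 (λ _ → refl) })
        (Run-≔ (Run-while Printed chunk
          (λ ((#w≡ , _) , this≡) → cong₂ _∸_ #w≡ this≡)
          (λ { j<w (at@(_ , _ , _ , _ , _ , stores) , refl) →
               running (⇓seq ⇓emit ⇓assign) ≤-refl ((at , refl) , cong (_∷ []) (stores j<w)) })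
          w (+-identityʳ w) (at , refl)))
      where
      chunk : ℕ → List ℕ
      chunk j = bit (s j) ∷ []
      chunks-tabulate : ∀ n j {f} → (∀ i → s (j + toℕ i) ≡ f i) →
                        chunks Printed chunk n j ≡ Vec.toList (Vec.map bit (tabulate {n = n} f))
      chunks-tabulate zero    j eq = refl
      chunks-tabulate (suc n) j eq = cong₂ _∷_
        (cong bit (trans (cong s (sym (+-identityʳ j))) (eq zero)))
        (chunks-tabulate n (suc j) (λ i → trans (cong s (sym (+-suc j (toℕ i)))) (eq (suc i))))

  -- Walking through the tree in amortised time

  opaque
    -- One bound for every pass of the main loop, dominated by the quadratic cost of `examine`. Its
    -- value stays hidden until `totalTime≤`.
    stepTime : ℕ
    stepTime = 50 + (w * (42 + w * 48) + w * 11)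

    -- Here 6 pays for the loop test and the mode test, `t` for `examine`, and `t′` for the rest,
    -- which is dearest when a leaf is printed.
    visit-time : ∀ {t t′} → t ≤ 10 + (w * (42 + w * 48) + 4) → t′ ≤ 24 + w * 11 → 6 + (t + t′) ≤ stepTime
    visit-time {t} {t′} t≤ t′≤ = begin
      6 + (t + t′)                                            ≤⟨ +-monoʳ-≤ 6 (+-mono-≤ t≤ t′≤) ⟩
      6 + ((10 + (w * (42 + w * 48) + 4)) + (24 + w * 11))    ≡⟨ regroup (w * (42 + w * 48)) (w * 11) ⟩
      44 + (w * (42 + w * 48) + w * 11)                       ≤⟨ +-monoˡ-≤ _ (≤ᵇ⇒≤ 44 50 _) ⟩
      stepTime                                                ∎
      where
      open ≤-Reasoning
      regroup : ∀ a b → 6 + ((10 + (a + 4)) + (24 + b)) ≡ 44 + (a + b)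
      regroup = solve 2 (λ a b → con 6 :+ ((con 10 :+ (a :+ con 4)) :+ (con 24 :+ b)) := con 44 :+ (a :+ b)) refl

    50≤stepTime : 50 ≤ stepTime
    50≤stepTime = m≤m+n 50 (w * (42 + w * 48) + w * 11)

  -- A partial run of the main loop, presented by its effect on the runs that
  -- continue it, since ⇓ only describes runs that halt.
  record Reaches (σ τ : State) (o : List ℕ) (T : ℕ) : Set where
    constructor reaching
    field
      {steps} : ℕ
      resume  : ∀ {υ o′ t′} → ⟨ search , τ ⟩⇓⟨ υ , o′ , t′ ⟩ → ⟨ search , σ ⟩⇓⟨ υ , o ++ o′ , steps + t′ ⟩
      steps≤T : steps ≤ T

  Reaches-step : ∀ {σ τ o t T} → var σ descending + var σ depth ≢ 0 →
                 ⟨ step , σ ⟩⇓⟨ τ , o , t ⟩ → 4 + t ≤ T → Reaches σ τ o T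
  Reaches-step ≢0 c≤ t≤ = reaching (⇓loop ≢0 c≤) t≤

  Reaches-trans : ∀ {σ τ υ o o′ T T′} → Reaches σ τ o T → Reaches τ υ o′ T′ →
                  Reaches σ υ (o ++ o′) (T + T′)
  Reaches-trans {σ} {o = o} {o′} (reaching {t} f t≤) (reaching {t′} g t′≤) = reaching
    (λ {υ} {o″} {t″} r → subst₂ (λ p n → ⟨ search , σ ⟩⇓⟨ υ , p , n ⟩)
      (sym (++-assoc o o′ o″)) (sym (+-assoc t t′ t″)) (f (g r)))
    (+-mono-≤ t≤ t′≤)

  Stores-choose⁺ : ∀ {d s f b e} → e ≡ d → Stores d s f → Stores (suc d) (choose s d b) (f [ e ↦ bit b ])
  Stores-choose⁺ {d} {s} {f} {b} refl stores j<1+d with m<1+n⇒m<n∨m≡n j<1+d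
  ... | inj₁ j<d  = trans (↦-minimal f (<⇒≢ j<d)) (trans (stores j<d) (cong bit (sym (choose-minimal {s} j<d))))
  ... | inj₂ refl = trans (↦-updates f d) (cong bit (sym (↦-updates s d)))

  Stores-choose⁻ : ∀ {d s f b} → Stores (suc d) (choose s d b) f → Stores d s f
  Stores-choose⁻ {s = s} stores j<d = trans (stores (m<n⇒m<1+n j<d)) (cong bit (choose-minimal {s} j<d))

  Moves : ℕ → (ℕ → Bool) → List ℕ → ℕ → State → ℕ → Set
  Moves d s o T σ m = ∃[ τ ] At m d s τ × Reaches σ τ o T

  1≢0 : ∀ {x n} → x ≡ suc n → x ≢ 0
  1≢0 refl ()

  visit-infeasible : ∀ {d s σ} → d ≤ w → At 1 d s σ → defect s d ≢ 0 → Moves d s [] stepTime σ 0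
  visit-infeasible d≤w at@(_ , _ , _ , _ , mode≡ , _) def≢0
    with running r t≤ (((#w≡ , #k≡ , matrix , depth≡ , _ , stores) , def≡) , refl) ← examine-run d≤w at =
    _ , (#w≡ , #k≡ , matrix , depth≡ , refl , stores) ,
    Reaches-step (λ ≡0 → 1≢0 mode≡ (m+n≡0⇒m≡0 _ ≡0))
      (⇓then (1≢0 mode≡) (⇓seq r (⇓then (λ ≡0 → def≢0 (trans (sym def≡) ≡0)) ⇓assign)))
      (visit-time t≤ (≤-trans (≤ᵇ⇒≤ 14 24 _) (m≤m+n 24 (w * 11))))

  visit-leaf : ∀ {s σ} → At 1 w s σ → defect s w ≡ 0 →
               Moves w s (Vec.toList (Vec.map bit (subset s))) stepTime σ 0
  visit-leaf {s} {σ} at@(_ , _ , _ , _ , mode≡ , _) def≡0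
    with running r t≤ ((at′@(#w≡ , _ , _ , depth≡ , _) , def≡) , refl) ← examine-run ≤-refl at
    with running r′ t′≤ ((#w≡′ , #k≡ , matrix , depth≡′ , _ , stores) , refl) ← print-run refl at′ =
    _ , (#w≡′ , #k≡ , matrix , depth≡′ , refl , stores) ,
    Reaches-step (λ ≡0 → 1≢0 mode≡ (m+n≡0⇒m≡0 _ ≡0))
      (subst (λ o → ⟨ step , σ ⟩⇓⟨ _ , o , _ ⟩) (++-identityʳ _)
        (⇓then (1≢0 mode≡) (⇓seq r (⇓else (trans def≡ def≡0)
          (⇓else (trans (cong₂ _∸_ #w≡ depth≡) (n∸n≡0 w)) (⇓seq r′ ⇓assign))))))
      (visit-time t≤ (≤-trans (+-monoʳ-≤ 16 (+-monoˡ-≤ 2 t′≤)) (≤-reflexive (regroup (w * 11)))))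
    where
    regroup : ∀ a → 16 + ((2 + (a + 4)) + 2) ≡ 24 + a
    regroup = solve 1 (λ a → con 16 :+ ((con 2 :+ (a :+ con 4)) :+ con 2) := con 24 :+ a) refl

  visit-branch : ∀ {d s σ} → d < w → At 1 d s σ → defect s d ≡ 0 →
                 Moves (suc d) (choose s d false) [] stepTime σ 1
  visit-branch {d} {s} d<w at@(_ , _ , _ , _ , mode≡ , _) def≡0
    with running r t≤ (((#w≡ , #k≡ , matrix , depth≡ , mode≡′ , stores) , def≡) , refl) ← examine-run (<⇒≤ d<w) at =
    _ , (#w≡ , #k≡ , matrix , cong suc depth≡ , mode≡′ , Stores-choose⁺ {s = s} depth≡ stores) ,
    Reaches-step (λ ≡0 → 1≢0 mode≡ (m+n≡0⇒m≡0 _ ≡0))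
      (⇓then (1≢0 mode≡) (⇓seq r (⇓else (trans def≡ def≡0)
        (⇓then (λ ≡0 → m>n⇒m∸n≢0 d<w (trans (sym (cong₂ _∸_ #w≡ depth≡)) ≡0)) (⇓seq ⇓store ⇓assign)))))
      (visit-time t≤ (≤-trans (≤ᵇ⇒≤ 23 24 _) (m≤m+n 24 (w * 11))))

  retreat-false : ∀ {d s σ} → At 0 (suc d) (choose s d false) σ →
                  Moves (suc d) (choose s d true) [] stepTime σ 1
  retreat-false {d} {s} {σ} (#w≡ , #k≡ , matrix , depth≡ , mode≡ , stores) =
    _ , (#w≡ , #k≡ , matrix , cong suc here≡ , refl , Stores-choose⁺ {s = s} here≡ (Stores-choose⁻ {s = s} stores)) ,
    Reaches-step (λ ≡0 → 1≢0 depth≡ (m+n≡0⇒n≡0 (var σ descending) ≡0))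
      (⇓else mode≡ (⇓seq ⇓assign (⇓else
        (trans (cong (arr σ chosen) here≡) (trans (stores ≤-refl) (cong bit (↦-updates s d))))
        (⇓seq ⇓store (⇓seq ⇓assign ⇓assign)))))
      (≤-trans (≤ᵇ⇒≤ _ 50 _) 50≤stepTime)
    where
    here≡ : var σ depth ∸ 1 ≡ d
    here≡ = cong (_∸ 1) depth≡

  retreat-true : ∀ {d s σ} → At 0 (suc d) (choose s d true) σ → Moves d s [] stepTime σ 0
  retreat-true {d} {s} {σ} (#w≡ , #k≡ , matrix , depth≡ , mode≡ , stores) =
    _ , (#w≡ , #k≡ , matrix , here≡ , mode≡ , Stores-choose⁻ {s = s} stores) ,
    Reaches-step (λ ≡0 → 1≢0 depth≡ (m+n≡0⇒n≡0 (var σ descending) ≡0))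
      (⇓else mode≡ (⇓seq ⇓assign (⇓then
        (1≢0 (trans (cong (arr σ chosen) here≡) (trans (stores ≤-refl) (cong bit (↦-updates s d)))))
        ⇓skip)))
      (≤-trans (≤ᵇ⇒≤ _ 50 _) 50≤stepTime)
    where
    here≡ : var σ depth ∸ 1 ≡ d
    here≡ = cong (_∸ 1) depth≡

  opaque
    -- The summand 1 is the single step spent on a cut-off node, where `n` is 0. Beyond it, each of
    -- the `n` ideals pays four steps for each of the `m + 1` levels down to its leaf.
    exploreTime : ℕ → ℕ → ℕ
    exploreTime m n = stepTime * (1 + 4 * (n * suc m))

    stepTime≤exploreTime : ∀ m n → stepTime ≤ exploreTime m n
    stepTime≤exploreTime m n = m≤m*n stepTime (1 + 4 * (n * suc m))

    -- Every visited inner node has a leaf below it, which pays for the five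
    -- steps spent on the node and on its subtrees' constant terms.
    explore-time : ∀ m n₀ n₁ → 1 ≤ n₀ + n₁ →
                   stepTime + (exploreTime m n₀ + (stepTime + (exploreTime m n₁ + stepTime))) ≤
                   exploreTime (suc m) (n₀ + n₁)
    explore-time m n₀ n₁ 1≤n = begin
      stepTime + (exploreTime m n₀ + (stepTime + (exploreTime m n₁ + stepTime)))
        ≡⟨ expandLHS stepTime m n₀ n₁ ⟩
      -- One of the five steps is the new constant term; the other four are isolated as `4 * 1`, to
      -- be charged to the ideals by `1≤n`.
      stepTime * (1 + (4 * ((n₀ + n₁) * suc m) + 4 * 1))
        ≤⟨ *-monoʳ-≤ stepTime (+-monoʳ-≤ 1 (+-monoʳ-≤ (4 * ((n₀ + n₁) * suc m)) (*-monoʳ-≤ 4 1≤n))) ⟩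
      stepTime * (1 + (4 * ((n₀ + n₁) * suc m) + 4 * (n₀ + n₁)))
        ≡⟨ expandRHS stepTime m n₀ n₁ ⟩
      exploreTime (suc m) (n₀ + n₁)  ∎
      where
      open ≤-Reasoning
      expandLHS : ∀ D m a b → D + (D * (1 + 4 * (a * suc m)) + (D + (D * (1 + 4 * (b * suc m)) + D))) ≡
                              D * (1 + (4 * ((a + b) * suc m) + 4 * 1))
      expandLHS = solve 4 (λ D m a b →
        D :+ (D :* (con 1 :+ con 4 :* (a :* (con 1 :+ m))) :+ (D :+ (D :* (con 1 :+ con 4 :* (b :* (con 1 :+ m))) :+ D)))
        := D :* (con 1 :+ (con 4 :* ((a :+ b) :* (con 1 :+ m)) :+ con 4 :* con 1))) refl
      expandRHS : ∀ D m a b → D * (1 + (4 * ((a + b) * suc m) + 4 * (a + b))) ≡ D * (1 + 4 * ((a + b) * suc (suc m)))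
      expandRHS = solve 4 (λ D m a b →
        D :* (con 1 :+ (con 4 :* ((a :+ b) :* (con 1 :+ m)) :+ con 4 :* (a :+ b)))
        := D :* (con 1 :+ con 4 :* ((a :+ b) :* (con 2 :+ m)))) refl

  Moves-cong : ∀ {d s o o′ T T′ σ m} → o ≡ o′ → T ≤ T′ → Moves d s o T σ m → Moves d s o′ T′ σ m
  Moves-cong refl T≤ (τ , at , reaching f t≤) = τ , at , reaching f (≤-trans t≤ T≤)

  Moves-trans : ∀ {d s o T σ m d′ s′ o′ T′ m′} → Moves d s o T σ m →
                (∀ {τ} → At m d s τ → Moves d′ s′ o′ T′ τ m′) →
                Moves d′ s′ (o ++ o′) (T + T′) σ m′
  Moves-trans (_ , at , r) next with τ , at′ , r′ ← next at = τ , at′ , Reaches-trans r r′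

  -- The list is a parameter so that the cases can be proved for explicit lists and then transported
  -- to `ideals` along its unfoldings.
  Explores : ℕ → ℕ → (ℕ → Bool) → List (Subset w) → Set
  Explores m d s Xs = ∀ {σ} → At 1 d s σ → Moves d s (encode Xs) (exploreTime m (length Xs)) σ 0

  explores-infeasible : ∀ m {d s} → d ≤ w → defect s d ≢ 0 → Explores m d s []
  explores-infeasible m d≤w def≢0 at =
    Moves-cong refl (stepTime≤exploreTime m 0) (visit-infeasible d≤w at def≢0)

  explores-leaf : ∀ {s} → defect s w ≡ 0 → Explores 0 w s (subset s ∷ [])
  explores-leaf {s} def≡0 at =
    Moves-cong (sym (++-identityʳ _)) (stepTime≤exploreTime 0 1) (visit-leaf at def≡0)

  explores-branch : ∀ m {d s Xs₀ Xs₁} → d < w → defect s d ≡ 0 → 1 ≤ length (Xs₀ ++ Xs₁) →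
                    Explores m (suc d) (choose s d false) Xs₀ →
                    Explores m (suc d) (choose s d true) Xs₁ →
                    Explores (suc m) d s (Xs₀ ++ Xs₁)
  explores-branch m {d} {s} {Xs₀} {Xs₁} d<w def≡0 1≤n explore₀ explore₁ {σ} at =
    Moves-cong output≡ time≤
      -- Three single steps surround the two subtrees: entering the first, turning to the second,
      -- and leaving it for the parent.
      (Moves-trans (visit-branch d<w at def≡0) λ at₁ →
       Moves-trans (explore₀ at₁) λ at₂ →
       Moves-trans (retreat-false {s = s} at₂) λ at₃ →
       Moves-trans (explore₁ at₃) (retreat-true {s = s}))
    where
    output≡ : encode Xs₀ ++ (encode Xs₁ ++ []) ≡ encode (Xs₀ ++ Xs₁)
    output≡ = trans (cong (encode Xs₀ ++_) (++-identityʳ (encode Xs₁)))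
                    (sym (concatMap-++ (λ X → Vec.toList (Vec.map bit X)) Xs₀ Xs₁))
    time≤ : stepTime + (exploreTime m (length Xs₀) + (stepTime + (exploreTime m (length Xs₁) + stepTime))) ≤
            exploreTime (suc m) (length (Xs₀ ++ Xs₁))
    time≤ = ≤-trans (explore-time m (length Xs₀) (length Xs₁) (subst (1 ≤_) (length-++ Xs₀) 1≤n))
                    (≤-reflexive (cong (exploreTime (suc m)) (sym (length-++ Xs₀))))

  explores : ∀ m {d s} → m + d ≡ w → Explores m d s (ideals m d s)
  explores m {d} {s} eq with defect s d ≟ 0
  ... | no def≢0 = subst (Explores m d s) (sym (ideals-infeasible m {d} {s} def≢0))
                     (explores-infeasible m (≤-trans (m≤n+m d m) (≤-reflexive eq)) def≢0)
  explores zero {s = s} refl | yes def≡0 =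
    subst (Explores 0 w s) (sym (ideals-feasible zero {w} {s} def≡0)) (explores-leaf {s} def≡0)
  explores (suc m) {d} {s} eq | yes def≡0 =
    subst (Explores (suc m) d s) (sym (ideals-feasible (suc m) {d} {s} def≡0))
      (explores-branch m {Xs₀ = ideals m (suc d) (choose s d false)} {ideals m (suc d) (choose s d true)}
        (open-choice eq) def≡0
        -- The amortisation rests on this: a feasible node has an ideal to charge.
        (subst (λ Xs → 1 ≤ length Xs) (ideals-feasible (suc m) {d} {s} def≡0) (ideals-nonempty (suc m) {d} {s} eq def≡0))
        (explores m (next-choice eq)) (explores m (next-choice eq)))

  -- The whole run and its constant

  root : ℕ → Bool
  root _ = false

  -- Before any choice both forced sets are empty, so feasibility reduces to `k ≤ w`. With
  -- `ideals-nonempty` it follows that at least one ideal exists.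
  root-defect : k ≤ w → defect root 0 ≡ 0
  root-defect k≤w = feasible⇒defect≡0 {root} {0} (feasible (λ _ ())
    (≤-trans (≤-reflexive none) z≤n) (≤-trans (≤-reflexive (cong (_+ k) none)) k≤w))
    where
    none : count (λ _ → false) w ≡ 0
    none = false⇒count≡0 w (λ _ → refl)

  enumerate-run : ∀ {σ} → At 0 0 root σ →
                  ∃₂ λ τ t → ⟨ enumerate , σ ⟩⇓⟨ τ , encode (ideals w 0 root) , t ⟩ ×
                             t ≤ 6 + exploreTime w (length (ideals w 0 root))
  enumerate-run {σ} (#w≡ , #k≡ , matrix , depth≡ , _ , stores) =
    finish (explores w (+-identityʳ w) (#w≡ , #k≡ , matrix , depth≡ , refl , stores))
    where
    finish : ∀ {o T} → Moves 0 root o T (setVar descending 1 σ) 0 →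
             ∃₂ λ τ t → ⟨ enumerate , σ ⟩⇓⟨ τ , o , t ⟩ × t ≤ 6 + T
    finish {o} {T} (τ , (_ , _ , _ , depth≡ , mode≡ , _) , reaching {t} resume t≤) =
      -- The initial assignment costs 2 and the final, failing loop test 4.
      τ , 2 + (t + 4) ,
      subst (λ p → ⟨ enumerate , σ ⟩⇓⟨ τ , p , _ ⟩) (++-identityʳ o)
        (⇓seq ⇓assign (resume (⇓done (cong₂ _+_ mode≡ depth≡)))) ,
      ≤-trans (≤-reflexive (cong (2 +_) (+-comm t 4))) (+-monoʳ-≤ 6 t≤)

  opaque
    unfolding stepTime exploreTime

    -- As `n` and `w` are positive, lower-order terms are absorbed: a step takes at most
    -- `151 * (w * w)`, there are at most `9 * (n * w)` steps, and `1365 = 6 + 151 * 9`.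
    totalTime≤ : ∀ n → 1 ≤ n → 1 ≤ w → 6 + exploreTime w n ≤ 1365 * (n * w ^ 3)
    totalTime≤ n 1≤n 1≤w = begin
      6 + stepTime * (1 + 4 * (n * suc w))
        ≤⟨ +-mono-≤ (*-monoʳ-≤ 6 1≤nw³) (*-mono-≤ stepTime≤ nodes≤) ⟩
      6 * (n * w ^ 3) + (151 * (w * w)) * (9 * (n * w))
        ≡⟨ collect n w ⟩
      1365 * (n * w ^ 3)  ∎
      where
      open ≤-Reasoning
      1≤nw³ : 1 ≤ n * w ^ 3
      1≤nw³ = *-mono-≤ 1≤n (*-mono-≤ 1≤w (*-mono-≤ 1≤w (*-mono-≤ 1≤w ≤-refl)))
      w≤w² : w ≤ w * w
      w≤w² = ≤-trans (≤-reflexive (sym (*-identityˡ w))) (*-monoˡ-≤ w 1≤w)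
      n≤nw : n ≤ n * w
      n≤nw = ≤-trans (≤-reflexive (sym (*-identityʳ n))) (*-monoʳ-≤ n 1≤w)
      stepTime≤ : stepTime ≤ 151 * (w * w)
      stepTime≤ = begin
        50 + (w * (42 + w * 48) + w * 11)
          ≡⟨ solve 1 (λ w → con 50 :+ (w :* (con 42 :+ w :* con 48) :+ w :* con 11)
                         := con 50 :* con 1 :+ (con 53 :* w :+ con 48 :* (w :* w))) refl w ⟩
        50 * 1 + (53 * w + 48 * (w * w))
          ≤⟨ +-mono-≤ (*-monoʳ-≤ 50 (*-mono-≤ 1≤w 1≤w)) (+-monoˡ-≤ (48 * (w * w)) (*-monoʳ-≤ 53 w≤w²)) ⟩
        50 * (w * w) + (53 * (w * w) + 48 * (w * w))
          ≡⟨ solve 1 (λ x → con 50 :* x :+ (con 53 :* x :+ con 48 :* x) := con 151 :* x) refl (w * w) ⟩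
        151 * (w * w)  ∎
      nodes≤ : 1 + 4 * (n * suc w) ≤ 9 * (n * w)
      nodes≤ = begin
        1 + 4 * (n * suc w)
          ≡⟨ solve 2 (λ n w → con 1 :+ con 4 :* (n :* (con 1 :+ w))
                           := con 1 :+ (con 4 :* n :+ con 4 :* (n :* w))) refl n w ⟩
        1 + (4 * n + 4 * (n * w))
          ≤⟨ +-mono-≤ (*-mono-≤ 1≤n 1≤w) (+-monoˡ-≤ (4 * (n * w)) (*-monoʳ-≤ 4 n≤nw)) ⟩
        n * w + (4 * (n * w) + 4 * (n * w))
          ≡⟨ solve 1 (λ x → x :+ (con 4 :* x :+ con 4 :* x) := con 9 :* x) refl (n * w) ⟩
        9 * (n * w)  ∎
      collect : ∀ n w → 6 * (n * w ^ 3) + (151 * (w * w)) * (9 * (n * w)) ≡ 1365 * (n * w ^ 3)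
      collect = solve 2 (λ n w →
        let nw³ = n :* (w :* (w :* (w :* con 1)))
        in  con 6 :* nw³ :+ (con 151 :* (w :* w)) :* (con 9 :* (n :* w)) := con 1365 :* nw³) refl

-- Posets with numbered elements

-- `count` recurses from the top, as the loops need, whereas vectors recurse from the front; this
-- mediates between the two.
count-suc : ∀ f n → count f (suc n) ≡ bit (f 0) + count (f ∘ suc) n
count-suc f zero    = sym (+-identityʳ (bit (f 0)))
count-suc f (suc n) = trans (cong (_+ bit (f (suc n))) (count-suc f n)) (+-assoc (bit (f 0)) _ _)

∣tabulate∣ : ∀ f n → ∣ tabulate {n = n} (f ∘ toℕ) ∣ ≡ count f n
∣tabulate∣ f zero = refl
∣tabulate∣ f (suc n) rewrite count-suc f n with f 0
... | true  = cong suc (∣tabulate∣ (f ∘ suc) n)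
... | false = ∣tabulate∣ (f ∘ suc) n

member : ∀ {n} → Subset n → ℕ → Bool
member []      _       = false
member (x ∷ X) zero    = x
member (x ∷ X) (suc p) = member X p

tabulate-member : ∀ {n} (X : Subset n) → tabulate (member X ∘ toℕ) ≡ X
tabulate-member []      = refl
tabulate-member (x ∷ X) = cong (x ∷_) (tabulate-member X)

∈-tabulate⁺ : ∀ {n f} {i : Fin n} → f (toℕ i) ≡ true → i ∈ˢ tabulate (f ∘ toℕ)
∈-tabulate⁺ {f = f} {i} fi = lookup⇒[]= i _ (trans (lookup∘tabulate (f ∘ toℕ) i) fi)

∈-tabulate⁻ : ∀ {n f} {i : Fin n} → i ∈ˢ tabulate (f ∘ toℕ) → f (toℕ i) ≡ true
∈-tabulate⁻ {f = f} {i} i∈ = trans (sym (lookup∘tabulate (f ∘ toℕ) i)) ([]=⇒lookup i∈)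

module Numbered (P : DecPoset 0ℓ 0ℓ 0ℓ) {w : ℕ} (ν : Numbering P w) where
  private module P = DecPoset P
  open Inverse ν using (to; from; to-cong; inverseˡ; inverseʳ)

  to∘from : ∀ i → to (from i) ≡ i
  to∘from i = inverseˡ P.Eq.refl

  from∘to : ∀ p → from (to p) P.≈ p
  from∘to p = inverseʳ refl

  toℕ-position : ∀ (i j : Fin w) → toℕ (combine i j) ≡ toℕ i * w + toℕ j
  toℕ-position i j = trans (toℕ-combine i j) (cong (_+ toℕ j) (*-comm w (toℕ i)))

  remQuot-position : ∀ {i j : Fin w} (p : toℕ i * w + toℕ j < w * w) → remQuot {w} w (fromℕ< p) ≡ (i , j)
  remQuot-position {i} {j} p = trans
    (cong (remQuot {w} w) (toℕ-injective (trans (toℕ-fromℕ< p) (sym (toℕ-position i j)))))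
    (remQuot-combine i j)

  entry : ∀ (i j : Fin w) → incidenceMatrix P ν (toℕ i * w + toℕ j) ≡ bit (does (from i P.≤? from j))
  entry i j with toℕ i * w + toℕ j <? w * w
  ... | no  i,j≮w² = contradiction (subst (_< w * w) (toℕ-position i j) (toℕ<n (combine i j))) i,j≮w²
  ... | yes i,j<w² = cong (λ (i , j) → bit (does (from i P.≤? from j))) (remQuot-position i,j<w²)

  -- Reading the order off the matrix gives a total function on numbers, free of bound proofs. It is
  -- tied to the poset only when both arguments are below `w`.
  le : ℕ → ℕ → Bool
  le a b = not (incidenceMatrix P ν (a * w + b) ≡ᵇ 0)

  le⁺ : ∀ i j → from i P.≤ from j → le (toℕ i) (toℕ j) ≡ true
  le⁺ i j i≤j rewrite entry i j with from i P.≤? from j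
  ... | yes _   = refl
  ... | no  i≰j = contradiction i≤j i≰j

  le⁻ : ∀ i j → le (toℕ i) (toℕ j) ≡ true → from i P.≤ from j
  le⁻ i j i≤j rewrite entry i j with yes i≤j′ ← from i P.≤? from j = i≤j′

  -- The order laws are proved on `Fin w`, where `from` applies, and carried over to bounded numbers
  -- in this way.
  Fin-elim : (Q : ℕ → Set) → (∀ (i : Fin w) → Q (toℕ i)) → ∀ {a} → a < w → Q a
  Fin-elim Q q a<w = subst Q (toℕ-fromℕ< a<w) (q (fromℕ< a<w))

  Fin-elim₂ : (Q : ℕ → ℕ → Set) → (∀ (i j : Fin w) → Q (toℕ i) (toℕ j)) → ∀ {a b} → a < w → b < w → Q a b
  Fin-elim₂ Q q a<w b<w = Fin-elim (λ a → Q a _) (λ i → Fin-elim (Q (toℕ i)) (q i) b<w) a<w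

  matrix : ∀ {a b} → a < w → b < w → incidenceMatrix P ν (a * w + b) ≡ bit (le a b)
  matrix = Fin-elim₂ (λ a b → incidenceMatrix P ν (a * w + b) ≡ bit (le a b)) λ i j → is-bit (entry i j)
    where
    is-bit : ∀ {x b} → x ≡ bit b → x ≡ bit (not (x ≡ᵇ 0))
    is-bit {b = true}  refl = refl
    is-bit {b = false} refl = refl

  le-refl : ∀ {a} → a < w → le a a ≡ true
  le-refl = Fin-elim (λ a → le a a ≡ true) (λ i → le⁺ i i P.refl)

  le-trans : ∀ {a b c} → a < w → b < w → c < w → le a b ≡ true → le b c ≡ true → le a c ≡ true
  le-trans {c = c} a<w b<w c<w =
    Fin-elim₂ (λ a b → le a b ≡ true → le b c ≡ true → le a c ≡ true)
      (λ i j → Fin-elim (λ c → le (toℕ i) (toℕ j) ≡ true → le (toℕ j) c ≡ true → le (toℕ i) c ≡ true)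
        (λ l i≤j j≤l → le⁺ i l (P.trans (le⁻ i j i≤j) (le⁻ j l j≤l))) c<w)
      a<w b<w

  le-antisym : ∀ {a b} → a < w → b < w → le a b ≡ true → le b a ≡ true → a ≡ b
  le-antisym = Fin-elim₂ (λ a b → le a b ≡ true → le b a ≡ true → a ≡ b)
    λ i j i≤j j≤i → cong toℕ (trans (sym (to∘from i)) (trans (to-cong (P.antisym (le⁻ i j i≤j) (le⁻ j i j≤i))) (to∘from j)))

  module _ (k : ℕ) where
    open Search w k le le-refl le-trans le-antisym

    isIdeal⇒isOrderIdeal : ∀ {s} → IsIdeal s → IsOrderIdeal P ν (subset s) × ∣ subset s ∣ ≡ k
    isIdeal⇒isOrderIdeal {s} (down , size) =
      (λ p q p∈ q≤p → ∈-tabulate⁺ {f = s} (down (toℕ<n (to p)) (toℕ<n (to q))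
        -- `q ≤ p` is moved to the representatives `from (to q)` and `from (to p)`, which are only
        -- equivalent to `q` and `p` in the setoid.
        (le⁺ (to q) (to p) (P.trans (P.reflexive (from∘to q)) (P.trans q≤p (P.reflexive (P.Eq.sym (from∘to p))))))
        (∈-tabulate⁻ {f = s} p∈))) ,
      trans (∣tabulate∣ s w) size

    isOrderIdeal⇒isIdeal : ∀ {s} → IsOrderIdeal P ν (subset s) → ∣ subset s ∣ ≡ k → IsIdeal s
    isOrderIdeal⇒isIdeal {s} ideal size =
      Fin-elim₂ (λ a b → le b a ≡ true → s a ≡ true → s b ≡ true)
        (λ i j j≤i si → ∈-tabulate⁻ {f = s} (subst (_∈ˢ subset s) (to∘from j)
          (ideal (from i) (from j) (subst (_∈ˢ subset s) (sym (to∘from i)) (∈-tabulate⁺ {f = s} si)) (le⁻ j i j≤i)))) ,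
      trans (sym (∣tabulate∣ s w)) size

    ideals-listing : ∀ s → IsListingOfIdeals P ν k (ideals w 0 s)
    ideals-listing s = ideals-unique w (+-identityʳ w) , λ X → mk⇔ (sound X) (complete X)
      where
      sound : ∀ X → X ∈ ideals w 0 s → IsOrderIdeal P ν X × ∣ X ∣ ≡ k
      sound X X∈ with s′ , refl , _ , ideal ← ideals-sound w (+-identityʳ w) X∈ = isIdeal⇒isOrderIdeal {s′} ideal
      complete : ∀ X → IsOrderIdeal P ν X × ∣ X ∣ ≡ k → X ∈ ideals w 0 s
      complete X (ideal , size) = subst (_∈ ideals w 0 s) X≡
        (ideals-complete w (+-identityʳ w) (λ ())
          (isOrderIdeal⇒isIdeal {member X} (subst (IsOrderIdeal P ν) (sym X≡) ideal) (trans (cong ∣_∣ X≡) size)))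
        where
        X≡ : subset (member X) ≡ X
        X≡ = tabulate-member X

corollary3 : Σ[ 𝒜 ∈ Program ] Σ[ C ∈ ℕ ]
    ((P : DecPoset 0ℓ 0ℓ 0ℓ) (w : ℕ) (ν : Numbering P w) (k : ℕ) → 1 ≤ k → k ≤ w →
    Σ[ Xs ∈ List (Subset w) ] Σ[ τ ∈ State ] Σ[ t ∈ ℕ ]
    (IsListingOfIdeals P ν k Xs
    × ⟨ 𝒜 , input P ν k ⟩⇓⟨ τ , encode Xs , t ⟩
    × t ≤ C * (length Xs * w ^ 3)))
corollary3 = enumerate , 1365 , λ P w ν k 1≤k k≤w →
  let open Numbered P ν
      open Search w k le le-refl le-trans le-antisym using (ideals; ideals-nonempty)
      open Correctness w k le le-refl le-trans le-antisym
      Xs = ideals w 0 root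
      -- In the input state `depth` and `descending` are 0, so that it already meets `At 0 0 root`.
      τ , t , run , t≤ = enumerate-run (refl , refl , matrix , refl , refl , λ ())
  in  Xs , τ , t , ideals-listing k root , run ,
      -- From `1 ≤ k ≤ w` come both positivity conditions: `k ≤ w` provides an ideal, and `w` is at
      -- least 1.
      ≤-trans t≤ (totalTime≤ (length Xs) (ideals-nonempty w (+-identityʳ w) (root-defect k≤w)) (≤-trans 1≤k k≤w))
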